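{- Let $(\Sigma,\mathsf{ar})$ be an at most countable binding signature with associated functors $F,F_\alpha:\mathsf{Nom}\to\mathsf{Nom}$, natural transformation $q:F\to F_\alpha$ and maps $a^{(n)}:F^n1\to F_\alpha^n1$. Let $T_\alpha$ be the final $F_\alpha$-coalgebra, $U:\mathsf{Nom}\to\mathsf{Set}$ the forgetful functor, $g:\lim_n UF^n1\to\lim_n UF_\alpha^n1$ the map induced by the $a^{(n)}$ (limits taken in $\mathsf{Set}$), and $\iota_\alpha:UT_\alpha\to\lim_n UF_\alpha^n1$ the map induced by the canonical cone from $T_\alpha$ to the terminal chain of $F_\alpha$. Let $P$ be the pullback in $\mathsf{Set}$ of $g$ and $\iota_\alpha$, with projection $h:P\to UT_\alpha$. Then $h$ is surjective.
   Context: Nominal sets: fix a countably infinite set $\mathcal V$ of names, $\mathfrak S(\mathcal V)$ the group of finite permutations; a nominal set is a set with a $\mathfrak S(\mathcal V)$-action in which every element has a finite support; $\mathsf{supp}(u)$ is the least support; $\mathsf{Nom}$ has equivariant maps. $[\mathcal V]X$ is the abstraction (quotient of $\mathcal V\times X$ by renaming of the first component: $(x_1,u_1)\sim(x_2,u_2)$ iff $(x_1\ z)\cdot u_1=(x_2\ z)\cdot u_2$ for some $z$ fresh for all four), with classes $\langle x\rangle u$; $\theta_X:\mathcal V\times X\to[\mathcal V]X$, $(x,u)\mapsto\langle x\rangle u$. Limits of $\omega^{op}$-chains in $\mathsf{Nom}$ are the finitely supported compatible tuples. For a binding signature ($\Sigma$ a set of operation symbols, each with arity a finite list $(n_1,\dots,n_k)$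 of naturals), define $F_\alpha X=\mathcal V+\coprod_{\mathsf{op}}[\mathcal V]^{n_1}X\times\cdots\times[\mathcal V]^{n_k}X$ and $F X=\mathcal V+\coprod_{\mathsf{op}}(\mathcal V^{n_1}\times X)\times\cdots\times(\mathcal V^{n_k}\times X)$, and $q_X:FX\to F_\alpha X$ the identity on the $\mathcal V$-summand and, on each factor, $(x^1,\dots,x^{n},u)\mapsto\langle x^1\rangle\langle x^2\rangle\cdots\langle x^n\rangle u$. Terminal chains: $1=\{*\}$, $!:F1\to 1$, and $F^{n+1}1\to F^n1$ is $F^n(!)$; likewise for $F_\alpha$. Define $a^{(0)}=\mathrm{id}_1$ and $a^{(n+1)}=q_{F_\alpha^n1}\circ F(a^{(n)}):F^{n+1}1\to F_\alpha^{n+1}1$; these commute with the chain maps. -}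

module Defs where

open import Algebra.Bundles using (Group)
open import Data.List.Base using (List; []; _∷_; _++_; map)
open import Data.List.Membership.Propositional using (_∈_; _∉_)
open import Data.List.Membership.Propositional.Properties using (∈-++⁺ˡ; ∈-++⁺ʳ; ∈-map⁺; ∈-map⁻)
open import Data.List.Relation.Unary.Any using (here; there)
open import Data.Nat.Base using (ℕ; zero; suc; _≤_; _⊔_)
open import Data.Nat.Properties using (m≤m⊔n; m≤n⊔m; ≤-trans; 1+n≰n) renaming (_≟_ to _≟ℕ_)
open import Data.Product.Base using (Σ; ∃; _×_; _,_; proj₁; proj₂)
open import Data.Product.Relation.Binary.Pointwise.NonDependent using (×-setoid)
open import Data.Sum.Base using (inj₁; inj₂)
open import Data.Sum.Relation.Binary.Pointwise using (⊎-setoid; inj₁; inj₂)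
open import Data.Unit.Base using (⊤; tt)
open import Function.Base using (_∘_)
open import Function.Bundles using (Func; Inverse; _↔_; _↣_; _⇔_; mk↔ₛ′; mk⇔)
open import Function.Properties.Inverse using (↔⇒↣)
open import Level using (0ℓ)
open import Relation.Binary.Bundles using (Setoid)
open import Relation.Binary.Definitions using (DecidableEquality)
open import Relation.Binary.PropositionalEquality using (_≡_; _≢_; refl; sym; trans; cong; subst; setoid)
open import Relation.Nullary using (yes; no; contradiction)
open import Relation.Nullary.Decidable using (via-injection)

-- Sets are rendered as setoids throughout, since [𝒱]X is a quotient.
-- lim and Pullback below are the limits in Set, with no support condition.

record Chain : Set₁ where
  field
    obj  : ℕ → Setoid 0ℓ 0ℓ
    step : ∀ n → Func (obj (suc n)) (obj n)

record ChainMap (A B : Chain) : Set where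
  private
    module A = Chain A
    module B = Chain B
  field
    at       : ∀ n → Func (A.obj n) (B.obj n)
    commutes : ∀ n s → Setoid._≈_ (B.obj n)
                 (Func.to (at n) (Func.to (A.step n) s))
                 (Func.to (B.step n) (Func.to (at (suc n)) s))

record Cone (X : Setoid 0ℓ 0ℓ) (A : Chain) : Set where
  private
    module A = Chain A
  field
    leg      : ∀ n → Func X (A.obj n)
    commutes : ∀ n u → Setoid._≈_ (A.obj n)
                 (Func.to (A.step n) (Func.to (leg (suc n)) u))
                 (Func.to (leg n) u)

record CompatibleTuple (A : Chain) : Set where
  open Chain A
  field
    component  : ∀ n → Setoid.Carrier (obj n)
    compatible : ∀ n → Setoid._≈_ (obj n) (Func.to (step n) (component (suc n))) (component n)

open CompatibleTuple

lim : Chain → Setoid 0ℓ 0ℓ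
lim A = record
  { Carrier       = CompatibleTuple A
  ; _≈_           = λ s t → ∀ n → Setoid._≈_ (obj n) (component s n) (component t n)
  ; isEquivalence = record
    { refl  = λ n → Setoid.refl (obj n)
    ; sym   = λ p n → Setoid.sym (obj n) (p n)
    ; trans = λ p q n → Setoid.trans (obj n) (p n) (q n)
    }
  }
  where open Chain A

limMap : ∀ {A B} → ChainMap A B → Func (lim A) (lim B)
limMap {A} {B} φ = record
  { to   = λ s → record
    { component  = λ n → Func.to (at n) (component s n)
    ; compatible = λ n → Setoid.trans (B.obj n)
        (Setoid.sym (B.obj n) (commutes n (component s (suc n))))
        (Func.cong (at n) (compatible s n))
    }
  ; cong = λ p n → Func.cong (at n) (p n)
  }
  where
  open ChainMap φ
  module B = Chain B

coneMap : ∀ {X A} → Cone X A → Func X (lim A)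
coneMap γ = record
  { to   = λ u → record
    { component  = λ n → Func.to (leg n) u
    ; compatible = λ n → commutes n u
    }
  ; cong = λ p n → Func.cong (leg n) p
  }
  where open Cone γ

module _ {A B C : Setoid 0ℓ 0ℓ} (f : Func A C) (g : Func B C) where

  private
    module A = Setoid A
    module B = Setoid B
    module C = Setoid C

  Pullback : Setoid 0ℓ 0ℓ
  Pullback = record
    { Carrier       = Σ (A.Carrier × B.Carrier) λ (a , b) → Func.to f a C.≈ Func.to g b
    ; _≈_           = λ ((a , b) , _) ((a′ , b′) , _) → a A.≈ a′ × b B.≈ b′
    ; isEquivalence = record
      { refl  = A.refl , B.refl
      ; sym   = λ (p , q) → A.sym p , B.sym q
      ; trans = λ (p , q) (p′ , q′) → A.trans p p′ , B.trans q q′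
      }
    }

  pullback₂ : Func Pullback B
  pullback₂ = record { to = λ ((_ , b) , _) → b ; cong = proj₂ }

record BindingSignature : Set₁ where
  field
    Op : Set
    ar : Op → List ℕ

AtMostCountable : Set → Set
AtMostCountable A = A ↣ ℕ

module Nominal (𝒱 : Set) (𝒱↔ℕ : 𝒱 ↔ ℕ) where

  _≟_ : DecidableEquality 𝒱
  _≟_ = via-injection (↔⇒↣ 𝒱↔ℕ) _≟ℕ_

  freshName : (S : List 𝒱) → ∃ λ z → z ∉ S
  freshName S = from (suc (bound S)) , λ z∈S →
    1+n≰n (subst (_≤ bound S) (strictlyInverseˡ (suc (bound S))) (≤bound z∈S))
    where
    open Inverse 𝒱↔ℕ using (to; from; strictlyInverseˡ)

    bound : List 𝒱 → ℕ
    bound []       = 0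
    bound (x ∷ xs) = to x ⊔ bound xs

    ≤bound : ∀ {x xs} → x ∈ xs → to x ≤ bound xs
    ≤bound {xs = y ∷ ys} (here refl) = m≤m⊔n (to y) (bound ys)
    ≤bound {xs = y ∷ ys} (there p)   = ≤-trans (≤bound p) (m≤n⊔m (to y) (bound ys))

  record Perm : Set where
    field
      bijection : 𝒱 ↔ 𝒱
      moved     : List 𝒱
      finite    : ∀ {x} → x ∉ moved → Inverse.to bijection x ≡ x

  infixl 9 _⟨$⟩_

  _⟨$⟩_ : Perm → 𝒱 → 𝒱
  π ⟨$⟩ x = Inverse.to (Perm.bijection π) x

  infix 4 _≈ₚ_

  _≈ₚ_ : Perm → Perm → Set
  π ≈ₚ ρ = ∀ x → π ⟨$⟩ x ≡ ρ ⟨$⟩ x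

  private
    εₚ : Perm
    εₚ = record
      { bijection = mk↔ₛ′ (λ x → x) (λ x → x) (λ _ → refl) (λ _ → refl)
      ; moved     = []
      ; finite    = λ _ → refl
      }

    _∙ₚ_ : Perm → Perm → Perm
    π ∙ₚ ρ = record
      { bijection = mk↔ₛ′ (π.to ∘ ρ.to) (ρ.from ∘ π.from)
          (λ x → trans (cong π.to (ρ.strictlyInverseˡ (π.from x))) (π.strictlyInverseˡ x))
          (λ x → trans (cong ρ.from (π.strictlyInverseʳ (ρ.to x))) (ρ.strictlyInverseʳ x))
      ; moved     = Perm.moved π ++ Perm.moved ρ
      ; finite    = λ x∉ → trans
          (cong π.to (Perm.finite ρ (x∉ ∘ ∈-++⁺ʳ (Perm.moved π))))
          (Perm.finite π (x∉ ∘ ∈-++⁺ˡ))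
      }
      where
      module π = Inverse (Perm.bijection π)
      module ρ = Inverse (Perm.bijection ρ)

    invₚ : Perm → Perm
    invₚ π = record
      { bijection = mk↔ₛ′ π.from π.to π.strictlyInverseʳ π.strictlyInverseˡ
      ; moved     = Perm.moved π
      ; finite    = λ {x} x∉ → trans (cong π.from (sym (Perm.finite π x∉))) (π.strictlyInverseʳ x)
      }
      where module π = Inverse (Perm.bijection π)

  𝔖 : Group 0ℓ 0ℓ
  𝔖 = record
    { Carrier = Perm
    ; _≈_     = _≈ₚ_
    ; _∙_     = _∙ₚ_
    ; ε       = εₚ
    ; _⁻¹     = invₚ
    ; isGroup = record
      { isMonoid = record
        { isSemigroup = record
          { isMagma = record
            { isEquivalence = record
              { refl  = λ _ → refl
              ; sym   = λ p x → sym (p x)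
              ; trans = λ p q x → trans (p x) (q x)
              }
            ; ∙-cong = λ {π} {π′} {ρ} {ρ′} p q x → trans (cong (π ⟨$⟩_) (q x)) (p (ρ′ ⟨$⟩ x))
            }
          ; assoc = λ _ _ _ _ → refl
          }
        ; identity = (λ _ _ → refl) , (λ _ _ → refl)
        }
      ; inverse = (λ π → Inverse.strictlyInverseʳ (Perm.bijection π))
                , (λ π → Inverse.strictlyInverseˡ (Perm.bijection π))
      ; ⁻¹-cong = λ {π} {ρ} p x → trans
          (cong (Inverse.from (Perm.bijection π))
            (sym (trans (p _) (Inverse.strictlyInverseˡ (Perm.bijection ρ) x))))
          (Inverse.strictlyInverseʳ (Perm.bijection π) _)
      }
    }

  open Group 𝔖 public using (_∙_; ε; _⁻¹)

  private
    swap : 𝒱 → 𝒱 → 𝒱 → 𝒱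
    swap x y v with v ≟ x | v ≟ y
    ... | yes _ | _     = y
    ... | no  _ | yes _ = x
    ... | no  _ | no  _ = v

    swap-l : ∀ x y → swap x y x ≡ y
    swap-l x y with x ≟ x | x ≟ y
    ... | yes _  | _ = refl
    ... | no x≢x | _ = contradiction refl x≢x

    swap-r : ∀ x y → swap x y y ≡ x
    swap-r x y with y ≟ x | y ≟ y
    ... | yes y≡x | _      = y≡x
    ... | no _    | yes _  = refl
    ... | no _    | no y≢y = contradiction refl y≢y

    swap-o : ∀ x y {v} → v ≢ x → v ≢ y → swap x y v ≡ v
    swap-o x y {v} v≢x v≢y with v ≟ x | v ≟ y
    ... | yes v≡x | _       = contradiction v≡x v≢x
    ... | no _    | yes v≡y = contradiction v≡y v≢y
    ... | no _    | no _    = refl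

    swap-invol : ∀ x y v → swap x y (swap x y v) ≡ v
    swap-invol x y v with v ≟ x | v ≟ y
    ... | yes refl | _        = swap-r x y
    ... | no _     | yes refl = swap-l x y
    ... | no v≢x   | no v≢y   = swap-o x y v≢x v≢y

  ⦅_,_⦆ : 𝒱 → 𝒱 → Perm
  ⦅ x , y ⦆ = record
    { bijection = mk↔ₛ′ (swap x y) (swap x y) (swap-invol x y) (swap-invol x y)
    ; moved     = x ∷ y ∷ []
    ; finite    = λ v∉ → swap-o x y (λ p → v∉ (here p)) (λ p → v∉ (there (here p)))
    }

  private
    perm-inj : ∀ π {x y} → π ⟨$⟩ x ≡ π ⟨$⟩ y → x ≡ y
    perm-inj π {x} {y} p = trans (sym (strictlyInverseʳ x)) (trans (cong from p) (strictlyInverseʳ y))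
      where open Inverse (Perm.bijection π)

    conj : ∀ π x y → π ∙ ⦅ x , y ⦆ ≈ₚ ⦅ π ⟨$⟩ x , π ⟨$⟩ y ⦆ ∙ π
    conj π x y v with v ≟ x | v ≟ y
    ... | yes refl | _        = sym (swap-l (π ⟨$⟩ x) (π ⟨$⟩ y))
    ... | no _     | yes refl = sym (swap-r (π ⟨$⟩ x) (π ⟨$⟩ y))
    ... | no v≢x   | no v≢y   =
      sym (swap-o (π ⟨$⟩ x) (π ⟨$⟩ y) (v≢x ∘ perm-inj π) (v≢y ∘ perm-inj π))

  record NomSet : Set₁ where
    no-eta-equality
    infixr 8 _·_
    field
      U : Setoid 0ℓ 0ℓ

    open Setoid U public

    field
      _·_    : Perm → Carrier → Carrier
      ·-cong : ∀ {π ρ u v} → π ≈ₚ ρ → u ≈ v → π · u ≈ ρ · v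
      ·-ε    : ∀ u → ε · u ≈ u
      ·-∙    : ∀ π ρ u → (π ∙ ρ) · u ≈ π · (ρ · u)

    _Supports_ : List 𝒱 → Carrier → Set
    S Supports u = ∀ π → (∀ {x} → x ∈ S → π ⟨$⟩ x ≡ x) → π · u ≈ u

    field
      finitelySupported : ∀ u → ∃ λ S → S Supports u

    IsSupp : List 𝒱 → Carrier → Set
    IsSupp S u = S Supports u × (∀ S′ → S′ Supports u → ∀ {x} → x ∈ S → x ∈ S′)

    -- z ∉ supp(u).  The least finite support cannot in general be computed
    -- from some finite support; "omitted by some finite support" says that z
    -- is not in the least one without having to exhibit it, see #⇔∉supp.
    _#_ : 𝒱 → Carrier → Set
    z # u = ∃ λ S → S Supports u × z ∉ S

    #⇔∉supp : ∀ {S u} → IsSupp S u → ∀ z → (z # u) ⇔ (z ∉ S)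
    #⇔∉supp {S} (supports , least) z = mk⇔
      (λ (S′ , supports′ , z∉S′) z∈S → z∉S′ (least S′ supports′ z∈S))
      (λ z∉S → S , supports , z∉S)

  private
    module _ (X : NomSet) where
      open NomSet X hiding (refl; sym; trans)

      cong· : ∀ π {u v} → u ≈ v → π · u ≈ π · v
      cong· π = ·-cong {π} {π} (λ _ → refl)

      conj· : ∀ π x y u → π · ⦅ x , y ⦆ · u ≈ ⦅ π ⟨$⟩ x , π ⟨$⟩ y ⦆ · π · u
      conj· π x y u = NomSet.trans X (NomSet.sym X (·-∙ π ⦅ x , y ⦆ u))
        (NomSet.trans X (·-cong (conj π x y) (NomSet.refl X)) (·-∙ _ π u))

      supports-swap : ∀ {S u z w} → S Supports u → z ∉ S → w ∉ S → ⦅ z , w ⦆ · u ≈ u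
      supports-swap {z = z} {w} sup z∉ w∉ = sup ⦅ z , w ⦆ λ x∈S →
        swap-o z w (λ { refl → z∉ x∈S }) (λ { refl → w∉ x∈S })

      supports-· : ∀ {S u} π → S Supports u → map (π ⟨$⟩_) S Supports (π · u)
      supports-· {S} {u} π sup ρ fix =
        NomSet.trans X (NomSet.sym X (·-∙ ρ π u))
        (NomSet.trans X (·-cong {ρ ∙ π} {π ∙ ((π ⁻¹) ∙ (ρ ∙ π))}
                           (λ x → sym (Inverse.strictlyInverseˡ (Perm.bijection π) _)) (NomSet.refl X))
        (NomSet.trans X (·-∙ π _ u)
        (cong· π (sup ((π ⁻¹) ∙ (ρ ∙ π)) λ x∈S →
          trans (cong ((π ⁻¹) ⟨$⟩_) (fix (∈-map⁺ (π ⟨$⟩_) x∈S)))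
                (Inverse.strictlyInverseʳ (Perm.bijection π) _)))))

      #-· : ∀ {z u} π → z # u → (π ⟨$⟩ z) # (π · u)
      #-· {z} π (S , sup , z∉S) = map (π ⟨$⟩_) S , supports-· π sup , λ πz∈ →
        let (y , y∈S , πz≡πy) = ∈-map⁻ (π ⟨$⟩_) πz∈
        in z∉S (subst (_∈ S) (sym (perm-inj π πz≡πy)) y∈S)

  infix 4 _⇒_ _≗_
  infixr 9 _∘ₙ_

  record _⇒_ (X Y : NomSet) : Set where
    no-eta-equality
    private
      module X = NomSet X
      module Y = NomSet Y
    field
      function    : Func X.U Y.U
      equivariant : ∀ π u → Func.to function (π X.· u) Y.≈ π Y.· Func.to function u

    open Func function public using (to; cong)

  open _⇒_ using (to; equivariant)

  _≗_ : ∀ {X Y} → X ⇒ Y → X ⇒ Y → Set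
  _≗_ {X} {Y} f g = ∀ u → NomSet._≈_ Y (to f u) (to g u)

  idₙ : ∀ {X} → X ⇒ X
  idₙ {X} = record
    { function    = record { to = λ u → u ; cong = λ p → p }
    ; equivariant = λ _ _ → NomSet.refl X
    }

  _∘ₙ_ : ∀ {X Y Z} → Y ⇒ Z → X ⇒ Y → X ⇒ Z
  _∘ₙ_ {Z = Z} g f = record
    { function    = record { to = to g ∘ to f ; cong = _⇒_.cong g ∘ _⇒_.cong f }
    ; equivariant = λ π u → NomSet.trans Z (_⇒_.cong g (equivariant f π u)) (equivariant g π (to f u))
    }

  𝟙 : NomSet
  𝟙 .NomSet.U                   = setoid ⊤
  𝟙 .NomSet._·_ _ _             = tt
  𝟙 .NomSet.·-cong _ _          = refl
  𝟙 .NomSet.·-ε _               = refl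
  𝟙 .NomSet.·-∙ _ _ _           = refl
  𝟙 .NomSet.finitelySupported _ = [] , λ _ _ → refl

  ! : ∀ {X} → X ⇒ 𝟙
  ! = record { function = record { to = λ _ → tt ; cong = λ _ → refl } ; equivariant = λ _ _ → refl }

  𝕍 : NomSet
  𝕍 .NomSet.U                     = setoid 𝒱
  𝕍 .NomSet._·_                   = _⟨$⟩_
  𝕍 .NomSet.·-cong {u = x} p refl = p x
  𝕍 .NomSet.·-ε _                 = refl
  𝕍 .NomSet.·-∙ _ _ _             = refl
  𝕍 .NomSet.finitelySupported x   = x ∷ [] , λ _ fix → fix (here refl)

  module _ (X Y : NomSet) where

    private
      module X = NomSet X
      module Y = NomSet Y

    infixr 7 _×ₙ_
    infixr 6 _⊎ₙ_

    _×ₙ_ : NomSet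
    _×ₙ_ .NomSet.U                         = ×-setoid X.U Y.U
    _×ₙ_ .NomSet._·_ π (u , v)             = π X.· u , π Y.· v
    _×ₙ_ .NomSet.·-cong p (q , r)          = X.·-cong p q , Y.·-cong p r
    _×ₙ_ .NomSet.·-ε (u , v)               = X.·-ε u , Y.·-ε v
    _×ₙ_ .NomSet.·-∙ π ρ (u , v)           = X.·-∙ π ρ u , Y.·-∙ π ρ v
    _×ₙ_ .NomSet.finitelySupported (u , v) =
      let (S , p) = X.finitelySupported u
          (T , q) = Y.finitelySupported v
      in S ++ T , λ π fix → p π (fix ∘ ∈-++⁺ˡ) , q π (fix ∘ ∈-++⁺ʳ S)

    _⊎ₙ_ : NomSet
    _⊎ₙ_ .NomSet.U                          = ⊎-setoid X.U Y.U
    _⊎ₙ_ .NomSet._·_ π (inj₁ u)             = inj₁ (π X.· u)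
    _⊎ₙ_ .NomSet._·_ π (inj₂ v)             = inj₂ (π Y.· v)
    _⊎ₙ_ .NomSet.·-cong p (inj₁ q)          = inj₁ (X.·-cong p q)
    _⊎ₙ_ .NomSet.·-cong p (inj₂ q)          = inj₂ (Y.·-cong p q)
    _⊎ₙ_ .NomSet.·-ε (inj₁ u)               = inj₁ (X.·-ε u)
    _⊎ₙ_ .NomSet.·-ε (inj₂ v)               = inj₂ (Y.·-ε v)
    _⊎ₙ_ .NomSet.·-∙ π ρ (inj₁ u)           = inj₁ (X.·-∙ π ρ u)
    _⊎ₙ_ .NomSet.·-∙ π ρ (inj₂ v)           = inj₂ (Y.·-∙ π ρ v)
    _⊎ₙ_ .NomSet.finitelySupported (inj₁ u) =
      let (S , p) = X.finitelySupported u in S , λ π fix → inj₁ (p π fix)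
    _⊎ₙ_ .NomSet.finitelySupported (inj₂ v) =
      let (S , p) = Y.finitelySupported v in S , λ π fix → inj₂ (p π fix)

  module _ {I : Set} (X : I → NomSet) where

    data ∐-≈ : (s t : Σ I λ i → NomSet.Carrier (X i)) → Set where
      inj : ∀ {i u v} → NomSet._≈_ (X i) u v → ∐-≈ (i , u) (i , v)

    ∐ₙ : NomSet
    ∐ₙ .NomSet.U = record
      { Carrier       = Σ I λ i → NomSet.Carrier (X i)
      ; _≈_           = ∐-≈
      ; isEquivalence = record
        { refl  = λ {(i , _)} → inj (NomSet.refl (X i))
        ; sym   = λ { {i , _} (inj p) → inj (NomSet.sym (X i) p) }
        ; trans = λ { {i , _} (inj p) (inj q) → inj (NomSet.trans (X i) p q) }
        }
      }
    ∐ₙ .NomSet._·_ π (i , u)                = i , NomSet._·_ (X i) π u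
    ∐ₙ .NomSet.·-cong {u = i , _} p (inj q) = inj (NomSet.·-cong (X i) p q)
    ∐ₙ .NomSet.·-ε (i , u)                  = inj (NomSet.·-ε (X i) u)
    ∐ₙ .NomSet.·-∙ π ρ (i , u)              = inj (NomSet.·-∙ (X i) π ρ u)
    ∐ₙ .NomSet.finitelySupported (i , u)    =
      let (S , p) = NomSet.finitelySupported (X i) u in S , λ π fix → inj (p π fix)

  infix 8 𝕍^_

  𝕍^_ : ℕ → NomSet
  𝕍^ zero  = 𝟙
  𝕍^ suc n = 𝕍 ×ₙ 𝕍^ n

  module _ (X : NomSet) where

    private
      module X = NomSet X

    infix 4 _∼_

    record _∼_ (s t : 𝒱 × X.Carrier) : Set where
      constructor ∼-intro
      private
        x₁ = proj₁ s
        u₁ = proj₂ s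
        x₂ = proj₁ t
        u₂ = proj₂ t
      field
        z    : 𝒱
        z≢x₁ : z ≢ x₁
        z≢x₂ : z ≢ x₂
        z#u₁ : z X.# u₁
        z#u₂ : z X.# u₂
        eq   : ⦅ x₁ , z ⦆ X.· u₁ X.≈ ⦅ x₂ , z ⦆ X.· u₂

    private
      ∼-reflexive : ∀ {x u v} → u X.≈ v → (x , u) ∼ (x , v)
      ∼-reflexive {x} {u} {v} p =
        let (S , sup)   = X.finitelySupported u
            (S′ , sup′) = X.finitelySupported v
            (z , z∉)    = freshName (x ∷ S ++ S′)
        in ∼-intro z (z∉ ∘ here) (z∉ ∘ here)
             (S , sup , λ q → z∉ (there (∈-++⁺ˡ q)))
             (S′ , sup′ , λ q → z∉ (there (∈-++⁺ʳ S q)))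
             (cong· X ⦅ x , z ⦆ p)

      ∼-sym : ∀ {s t} → s ∼ t → t ∼ s
      ∼-sym (∼-intro z a b c d e) = ∼-intro z b a d c (X.sym e)

      rename-swap : ∀ {x u z w} (z#u : z X.# u) → z ≢ x → w ≢ x → w ∉ proj₁ z#u →
                    ⦅ z , w ⦆ X.· ⦅ x , z ⦆ X.· u X.≈ ⦅ x , w ⦆ X.· u
      rename-swap {x} {u} {z} {w} (S , sup , z∉S) z≢x w≢x w∉S = X.trans (conj· X ⦅ z , w ⦆ x z u)
        (X.·-cong
          (λ v → trans (cong (λ a → swap a (swap z w z) v) (swap-o z w (z≢x ∘ sym) (w≢x ∘ sym)))
                       (cong (λ b → swap x b v) (swap-l z w)))
          (supports-swap X sup z∉S w∉S))

      refresh : ∀ {x₁ u₁ x₂ u₂} (p : (x₁ , u₁) ∼ (x₂ , u₂)) {w} →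
                w ≢ x₁ → w ≢ x₂ → w ∉ proj₁ (_∼_.z#u₁ p) → w ∉ proj₁ (_∼_.z#u₂ p) →
                ⦅ x₁ , w ⦆ X.· u₁ X.≈ ⦅ x₂ , w ⦆ X.· u₂
      refresh (∼-intro z z≢x₁ z≢x₂ z#u₁ z#u₂ eq) {w} w≢x₁ w≢x₂ w∉₁ w∉₂ =
        X.trans (X.sym (rename-swap z#u₁ z≢x₁ w≢x₁ w∉₁))
        (X.trans (cong· X ⦅ z , w ⦆ eq) (rename-swap z#u₂ z≢x₂ w≢x₂ w∉₂))

      ∼-trans : ∀ {r s t} → r ∼ s → s ∼ t → r ∼ t
      ∼-trans {x₁ , u₁} {x₂ , u₂} {x₃ , u₃} p q =
        let (S₁ , sup₁ , _) = _∼_.z#u₁ p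
            (S₂ , _)        = _∼_.z#u₂ p
            (S₃ , _)        = _∼_.z#u₁ q
            (S₄ , sup₄ , _) = _∼_.z#u₂ q
            (w , w∉)        = freshName (x₁ ∷ x₂ ∷ x₃ ∷ S₁ ++ S₂ ++ S₃ ++ S₄)
            w∉S             = λ m → w∉ (there (there (there m)))
            w≢x₁ = w∉ ∘ here
            w≢x₂ = λ e → w∉ (there (here e))
            w≢x₃ = λ e → w∉ (there (there (here e)))
            w∉₁  = w∉S ∘ ∈-++⁺ˡ
            w∉₂  = w∉S ∘ ∈-++⁺ʳ S₁ ∘ ∈-++⁺ˡ
            w∉₃  = w∉S ∘ ∈-++⁺ʳ S₁ ∘ ∈-++⁺ʳ S₂ ∘ ∈-++⁺ˡ
            w∉₄  = w∉S ∘ ∈-++⁺ʳ S₁ ∘ ∈-++⁺ʳ S₂ ∘ ∈-++⁺ʳ S₃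
        in ∼-intro w w≢x₁ w≢x₃ (S₁ , sup₁ , w∉₁) (S₄ , sup₄ , w∉₄)
             (X.trans (refresh p w≢x₁ w≢x₂ w∉₁ w∉₂) (refresh q w≢x₂ w≢x₃ w∉₃ w∉₄))

      ∼-· : ∀ π {x₁ u₁ x₂ u₂} → (x₁ , u₁) ∼ (x₂ , u₂) →
            (π ⟨$⟩ x₁ , π X.· u₁) ∼ (π ⟨$⟩ x₂ , π X.· u₂)
      ∼-· π (∼-intro z a b c d e) = ∼-intro (π ⟨$⟩ z) (a ∘ perm-inj π) (b ∘ perm-inj π)
        (#-· X π c) (#-· X π d)
        (X.trans (X.sym (conj· X π _ z _)) (X.trans (cong· X π e) (conj· X π _ z _)))

      ∼-≡ : ∀ {x y u v} → x ≡ y → u X.≈ v → (x , u) ∼ (y , v)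
      ∼-≡ refl = ∼-reflexive

    [𝕍]_ : NomSet
    [𝕍]_ .NomSet.U = record
      { Carrier       = 𝒱 × X.Carrier
      ; _≈_           = _∼_
      ; isEquivalence = record { refl = ∼-reflexive X.refl ; sym = ∼-sym ; trans = ∼-trans }
      }
    [𝕍]_ .NomSet._·_ π (x , u)              = π ⟨$⟩ x , π X.· u
    [𝕍]_ .NomSet.·-cong {ρ = ρ} {x , _} p q =
      ∼-trans (∼-≡ (p x) (X.·-cong p X.refl)) (∼-· ρ q)
    [𝕍]_ .NomSet.·-ε (x , u)                = ∼-reflexive (X.·-ε u)
    [𝕍]_ .NomSet.·-∙ π ρ (x , u)            = ∼-reflexive (X.·-∙ π ρ u)
    [𝕍]_ .NomSet.finitelySupported (x , u)  =
      let (S , sup) = X.finitelySupported u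
      in x ∷ S , λ π fix → ∼-≡ (fix (here refl)) (sup π (fix ∘ there))

    θ : 𝕍 ×ₙ X ⇒ [𝕍]_
    θ = record
      { function    = record { to = λ (x , u) → x , u ; cong = λ (p , q) → ∼-≡ p q }
      ; equivariant = λ _ _ → ∼-reflexive X.refl
      }

  record Endofunctor : Set₁ where
    no-eta-equality
    field
      F₀           : NomSet → NomSet
      F₁           : ∀ {X Y} → X ⇒ Y → F₀ X ⇒ F₀ Y
      F-resp-≗     : ∀ {X Y} {f g : X ⇒ Y} → f ≗ g → F₁ f ≗ F₁ g
      identity     : ∀ {X} → F₁ (idₙ {X}) ≗ idₙ
      homomorphism : ∀ {X Y Z} (g : Y ⇒ Z) (f : X ⇒ Y) → F₁ (g ∘ₙ f) ≗ F₁ g ∘ₙ F₁ f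

  open Endofunctor

  record _⟹_ (F G : Endofunctor) : Set₁ where
    no-eta-equality
    field
      η       : ∀ X → F₀ F X ⇒ F₀ G X
      natural : ∀ {X Y} (f : X ⇒ Y) → η Y ∘ₙ F₁ F f ≗ F₁ G f ∘ₙ η X

  open _⟹_

  Id : Endofunctor
  Id = record
    { F₀           = λ X → X
    ; F₁           = λ f → f
    ; F-resp-≗     = λ p → p
    ; identity     = λ {X} _ → NomSet.refl X
    ; homomorphism = λ {Z = Z} _ _ _ → NomSet.refl Z
    }

  Const : NomSet → Endofunctor
  Const A = record
    { F₀           = λ _ → A
    ; F₁           = λ _ → idₙ
    ; F-resp-≗     = λ _ _ → NomSet.refl A
    ; identity     = λ _ → NomSet.refl A
    ; homomorphism = λ _ _ _ → NomSet.refl A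
    }

  infixr 9 _∘ᶠ_
  infixr 7 _×ᶠ_
  infixr 6 _+ᶠ_

  _∘ᶠ_ : Endofunctor → Endofunctor → Endofunctor
  G ∘ᶠ F = record
    { F₀           = λ X → F₀ G (F₀ F X)
    ; F₁           = λ f → F₁ G (F₁ F f)
    ; F-resp-≗     = λ {f = f} {g} p → F-resp-≗ G {f = F₁ F f} {F₁ F g} (F-resp-≗ F {f = f} {g} p)
    ; identity     = λ {X} u → NomSet.trans (F₀ G (F₀ F X))
        (F-resp-≗ G {f = F₁ F idₙ} {idₙ} (identity F) u) (identity G u)
    ; homomorphism = λ {Z = Z} g f u → NomSet.trans (F₀ G (F₀ F Z))
        (F-resp-≗ G {f = F₁ F (g ∘ₙ f)} {F₁ F g ∘ₙ F₁ F f} (homomorphism F g f) u)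
        (homomorphism G (F₁ F g) (F₁ F f) u)
    }

  _×₁_ : ∀ {X Y X′ Y′} → X ⇒ X′ → Y ⇒ Y′ → X ×ₙ Y ⇒ X′ ×ₙ Y′
  f ×₁ g = record
    { function    = record
      { to   = λ (u , v) → to f u , to g v
      ; cong = λ (p , q) → _⇒_.cong f p , _⇒_.cong g q
      }
    ; equivariant = λ π (u , v) → equivariant f π u , equivariant g π v
    }

  _+₁_ : ∀ {X Y X′ Y′} → X ⇒ X′ → Y ⇒ Y′ → X ⊎ₙ Y ⇒ X′ ⊎ₙ Y′
  f +₁ g = record
    { function    = record
      { to   = λ { (inj₁ u) → inj₁ (to f u) ; (inj₂ v) → inj₂ (to g v) }
      ; cong = λ { (inj₁ p) → inj₁ (_⇒_.cong f p) ; (inj₂ q) → inj₂ (_⇒_.cong g q) }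
      }
    ; equivariant = λ { π (inj₁ u) → inj₁ (equivariant f π u) ; π (inj₂ v) → inj₂ (equivariant g π v) }
    }

  ∐₁ : ∀ {I : Set} {X Y : I → NomSet} → (∀ i → X i ⇒ Y i) → ∐ₙ X ⇒ ∐ₙ Y
  ∐₁ f = record
    { function    = record
      { to   = λ (i , u) → i , to (f i) u
      ; cong = λ { {i , _} (inj p) → inj (_⇒_.cong (f i) p) }
      }
    ; equivariant = λ π (i , u) → inj (equivariant (f i) π u)
    }

  [𝕍]₁ : ∀ {X Y} → X ⇒ Y → [𝕍] X ⇒ [𝕍] Y
  [𝕍]₁ {X} {Y} f = record
    { function    = record
      { to   = λ (x , u) → x , to f u
      ; cong = λ (∼-intro z a b c d e) → ∼-intro z a b (#-to c) (#-to d)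
          (Y.trans (Y.sym (equivariant f _ _)) (Y.trans (_⇒_.cong f e) (equivariant f _ _)))
      }
    ; equivariant = λ π (x , u) → _⇒_.cong (θ Y) (refl , equivariant f π u)
    }
    where
    module X = NomSet X
    module Y = NomSet Y

    #-to : ∀ {z u} → z X.# u → z Y.# to f u
    #-to (S , sup , z∉S) = S , (λ π fix →
      Y.trans (Y.sym (equivariant f π _)) (_⇒_.cong f (sup π fix))) , z∉S

  _×ᶠ_ : Endofunctor → Endofunctor → Endofunctor
  F ×ᶠ G = record
    { F₀           = λ X → F₀ F X ×ₙ F₀ G X
    ; F₁           = λ f → F₁ F f ×₁ F₁ G f
    ; F-resp-≗     = λ {f = f} {g} p (u , v) → F-resp-≗ F {f = f} {g} p u , F-resp-≗ G {f = f} {g} p v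
    ; identity     = λ (u , v) → identity F u , identity G v
    ; homomorphism = λ g f (u , v) → homomorphism F g f u , homomorphism G g f v
    }

  _+ᶠ_ : Endofunctor → Endofunctor → Endofunctor
  F +ᶠ G = record
    { F₀           = λ X → F₀ F X ⊎ₙ F₀ G X
    ; F₁           = λ f → F₁ F f +₁ F₁ G f
    ; F-resp-≗     = λ
        { {f = f} {g} p (inj₁ u) → inj₁ (F-resp-≗ F {f = f} {g} p u)
        ; {f = f} {g} p (inj₂ v) → inj₂ (F-resp-≗ G {f = f} {g} p v)
        }
    ; identity     = λ { (inj₁ u) → inj₁ (identity F u) ; (inj₂ v) → inj₂ (identity G v) }
    ; homomorphism = λ
        { g f (inj₁ u) → inj₁ (homomorphism F g f u)
        ; g f (inj₂ v) → inj₂ (homomorphism G g f v)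
        }
    }

  ∐ᶠ : {I : Set} → (I → Endofunctor) → Endofunctor
  ∐ᶠ F = record
    { F₀           = λ X → ∐ₙ λ i → F₀ (F i) X
    ; F₁           = λ f → ∐₁ λ i → F₁ (F i) f
    ; F-resp-≗     = λ {f = f} {g} p (i , u) → inj (F-resp-≗ (F i) {f = f} {g} p u)
    ; identity     = λ (i , u) → inj (identity (F i) u)
    ; homomorphism = λ g f (i , u) → inj (homomorphism (F i) g f u)
    }

  Abs : Endofunctor
  Abs = record
    { F₀           = [𝕍]_
    ; F₁           = [𝕍]₁
    ; F-resp-≗     = λ {Y = Y} p (x , u) → _⇒_.cong (θ Y) (refl , p u)
    ; identity     = λ {X} _ → NomSet.refl ([𝕍] X)
    ; homomorphism = λ {Z = Z} _ _ _ → NomSet.refl ([𝕍] Z)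
    }

  Abs^ : ℕ → Endofunctor
  Abs^ zero    = Id
  Abs^ (suc n) = Abs ∘ᶠ Abs^ n

  ∏ᶠ : (ℕ → Endofunctor) → List ℕ → Endofunctor
  ∏ᶠ F []       = Const 𝟙
  ∏ᶠ F (n ∷ ns) = F n ×ᶠ ∏ᶠ F ns

  idᵗ : ∀ {F} → F ⟹ F
  idᵗ {F} = record { η = λ _ → idₙ ; natural = λ {Y = Y} _ _ → NomSet.refl (F₀ F Y) }

  _×ᵗ_ : ∀ {F G F′ G′} → F ⟹ F′ → G ⟹ G′ → (F ×ᶠ G) ⟹ (F′ ×ᶠ G′)
  α ×ᵗ β = record
    { η       = λ X → η α X ×₁ η β X
    ; natural = λ f (u , v) → natural α f u , natural β f v
    }

  _+ᵗ_ : ∀ {F G F′ G′} → F ⟹ F′ → G ⟹ G′ → (F +ᶠ G) ⟹ (F′ +ᶠ G′)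
  α +ᵗ β = record
    { η       = λ X → η α X +₁ η β X
    ; natural = λ { f (inj₁ u) → inj₁ (natural α f u) ; f (inj₂ v) → inj₂ (natural β f v) }
    }

  ∐ᵗ : ∀ {I : Set} {F G : I → Endofunctor} → (∀ i → F i ⟹ G i) → ∐ᶠ F ⟹ ∐ᶠ G
  ∐ᵗ α = record
    { η       = λ X → ∐₁ λ i → η (α i) X
    ; natural = λ f (i , u) → inj (natural (α i) f u)
    }

  ∏ᵗ : ∀ {F G : ℕ → Endofunctor} → (∀ n → F n ⟹ G n) → ∀ ns → ∏ᶠ F ns ⟹ ∏ᶠ G ns
  ∏ᵗ α []       = idᵗ
  ∏ᵗ α (n ∷ ns) = α n ×ᵗ ∏ᵗ α ns

  ×-assoc : ∀ {X Y Z} → (X ×ₙ Y) ×ₙ Z ⇒ X ×ₙ (Y ×ₙ Z)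
  ×-assoc {X} {Y} {Z} = record
    { function    = record
      { to   = λ ((u , v) , w) → u , (v , w)
      ; cong = λ ((p , q) , r) → p , (q , r)
      }
    ; equivariant = λ _ _ → NomSet.refl X , (NomSet.refl Y , NomSet.refl Z)
    }

  ×-proj₂ : ∀ {X Y} → X ×ₙ Y ⇒ Y
  ×-proj₂ {Y = Y} = record
    { function    = record { to = proj₂ ; cong = proj₂ }
    ; equivariant = λ _ _ → NomSet.refl Y
    }

  -- ((x¹ , … , xⁿ) , u) ↦ ⟨x¹⟩⋯⟨xⁿ⟩u
  θ^ : ∀ n X → 𝕍^ n ×ₙ X ⇒ F₀ (Abs^ n) X
  θ^ zero    X = ×-proj₂
  θ^ (suc n) X = θ (F₀ (Abs^ n) X) ∘ₙ (idₙ ×₁ θ^ n X) ∘ₙ ×-assoc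

  θ^-natural : ∀ n → (Const (𝕍^ n) ×ᶠ Id) ⟹ Abs^ n
  θ^-natural n = record { η = θ^ n ; natural = go n }
    where
    go : ∀ n {X Y} (f : X ⇒ Y) → θ^ n Y ∘ₙ (idₙ ×₁ f) ≗ F₁ (Abs^ n) f ∘ₙ θ^ n X
    go zero    {Y = Y} f _              = NomSet.refl Y
    go (suc n) {Y = Y} f ((x , xs) , u) = _⇒_.cong (θ (F₀ (Abs^ n) Y)) (refl , go n f (xs , u))

  record Coalgebra (F : Endofunctor) : Set₁ where
    field
      carrier   : NomSet
      structure : carrier ⇒ F₀ F carrier

  open Coalgebra

  record CoalgebraHom {F : Endofunctor} (C D : Coalgebra F) : Set where
    field
      hom      : carrier C ⇒ carrier D
      commutes : structure D ∘ₙ hom ≗ F₁ F hom ∘ₙ structure C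

  open CoalgebraHom

  IsFinal : ∀ {F} → Coalgebra F → Set₁
  IsFinal {F} T = ∀ (C : Coalgebra F) →
    Σ (CoalgebraHom C T) λ f → ∀ (f′ : CoalgebraHom C T) → hom f′ ≗ hom f

  module _ (F : Endofunctor) where

    _^_𝟙 : ℕ → NomSet
    _^_𝟙 zero    = 𝟙
    _^_𝟙 (suc n) = F₀ F (_^_𝟙 n)

    connecting : ∀ n → _^_𝟙 (suc n) ⇒ _^_𝟙 n
    connecting zero    = !
    connecting (suc n) = F₁ F (connecting n)

    U-terminalChain : Chain
    U-terminalChain = record
      { obj  = λ n → NomSet.U (_^_𝟙 n)
      ; step = λ n → _⇒_.function (connecting n)
      }

  module _ {F : Endofunctor} (T : Coalgebra F) where

    canonical : ∀ n → carrier T ⇒ F ^ n 𝟙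
    canonical zero    = !
    canonical (suc n) = F₁ F (canonical n) ∘ₙ structure T

    canonicalCone : Cone (NomSet.U (carrier T)) (U-terminalChain F)
    canonicalCone = record { leg = λ n → _⇒_.function (canonical n) ; commutes = go }
      where
      go : ∀ n → connecting F n ∘ₙ canonical (suc n) ≗ canonical n
      go zero    u = refl
      go (suc n) u = NomSet.trans (F ^ suc n 𝟙)
        (NomSet.sym (F ^ suc n 𝟙) (homomorphism F (connecting F n) (canonical (suc n)) (to (structure T) u)))
        (F-resp-≗ F {f = connecting F n ∘ₙ canonical (suc n)} {canonical n} (go n) (to (structure T) u))

    ι : Func (NomSet.U (carrier T)) (lim (U-terminalChain F))
    ι = coneMap canonicalCone

  module _ {F G : Endofunctor} (q : F ⟹ G) where

    a : ∀ n → F ^ n 𝟙 ⇒ G ^ n 𝟙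
    a zero    = idₙ
    a (suc n) = η q (G ^ n 𝟙) ∘ₙ F₁ F (a n)

    a-chainMap : ChainMap (U-terminalChain F) (U-terminalChain G)
    a-chainMap = record { at = λ n → _⇒_.function (a n) ; commutes = go }
      where
      go : ∀ n → a n ∘ₙ connecting F n ≗ connecting G n ∘ₙ a (suc n)
      go zero    s = refl
      go (suc n) s = NomSet.trans (G ^ suc n 𝟙)
        (_⇒_.cong (η q (G ^ n 𝟙))
          (NomSet.trans (F₀ F (G ^ n 𝟙))
            (NomSet.sym (F₀ F (G ^ n 𝟙)) (homomorphism F (a n) (connecting F n) s))
            (NomSet.trans (F₀ F (G ^ n 𝟙))
              (F-resp-≗ F {f = a n ∘ₙ connecting F n} {connecting G n ∘ₙ a (suc n)} (go n) s)
              (homomorphism F (connecting G n) (a (suc n)) s))))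
        (natural q (connecting G n) (to (F₁ F (a (suc n))) s))

    lim-a : Func (lim (U-terminalChain F)) (lim (U-terminalChain G))
    lim-a = limMap a-chainMap

  module _ (S : BindingSignature) where
    open BindingSignature S

    F : Endofunctor
    F = Const 𝕍 +ᶠ ∐ᶠ λ op → ∏ᶠ (λ n → Const (𝕍^ n) ×ᶠ Id) (ar op)

    Fα : Endofunctor
    Fα = Const 𝕍 +ᶠ ∐ᶠ λ op → ∏ᶠ Abs^ (ar op)

    q : F ⟹ Fα
    q = idᵗ +ᵗ ∐ᵗ λ op → ∏ᵗ θ^-natural (ar op)

    g : Func (lim (U-terminalChain F)) (lim (U-terminalChain Fα))
    g = lim-a q

    module _ (Tα : Coalgebra Fα) where

      P : Setoid 0ℓ 0ℓ
      P = Pullback g (ι Tα)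

      h : Func P (NomSet.U (carrier Tα))
      h = pullback₂ g (ι Tα)

{-# OPTIONS --safe #-}
module Submission where

open import Defs
open import Data.List.Base using ([]; _∷_)
open import Data.Nat.Base using (ℕ; zero; suc)
open import Data.Product.Base using (_,_; proj₂)
open import Data.Sum.Base using (inj₁; inj₂)
open import Data.Sum.Relation.Binary.Pointwise using (inj₁; inj₂)
open import Data.Unit.Base using (tt)
open import Function.Bundles using (_↔_; Func)
open import Function.Definitions using (Surjective)
open import Relation.Binary.Bundles using (Setoid)
open import Relation.Binary.PropositionalEquality using (refl)

-- A representative of a class in [𝒱]X is a pair of a name and an element of X,
-- so unfolding u ∈ Tα along its structure map while remembering the chosen
-- binders produces, for every n, an element of Fⁿ1.  The depth n + 1 unfolding
-- reuses the choices made at depth n, so these elements form a compatible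
-- tuple, and q forgets the choices, so g sends that tuple to ι u.  The choice
-- of binders is neither equivariant nor compatible with ≈, hence the unfolding
-- is a bare function on carriers; its supports may grow with n, which is
-- harmless because the limits are taken in Set.

module _ (𝒱 : Set) (𝒱↔ℕ : 𝒱 ↔ ℕ) where
  open Nominal 𝒱 𝒱↔ℕ
  open NomSet using (Carrier)
  open _⇒_ using (to; cong)
  open Endofunctor using (F₀; F₁)
  open _⟹_ using (η)

  module _ {X Y : NomSet} (f : Carrier X → Carrier Y) where

    chooseAbs : ∀ n → Carrier (F₀ (Abs^ n) X) → Carrier (𝕍^ n ×ₙ Y)
    chooseAbs zero    u       = tt , f u
    chooseAbs (suc n) (x , u) = let (xs , v) = chooseAbs n u in (x , xs) , v

    choose∏ : ∀ ns → Carrier (F₀ (∏ᶠ Abs^ ns) X) →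
              Carrier (F₀ (∏ᶠ (λ n → Const (𝕍^ n) ×ᶠ Id) ns) Y)
    choose∏ []       _       = tt
    choose∏ (n ∷ ns) (u , s) = chooseAbs n u , choose∏ ns s

    choose : ∀ S → Carrier (F₀ (Fα S) X) → Carrier (F₀ (F S) Y)
    choose S (inj₁ x)        = inj₁ x
    choose S (inj₂ (op , s)) = inj₂ (op , choose∏ (BindingSignature.ar S op) s)

  module _ {X Y Z : NomSet} (k : Y ⇒ Z) {f : Carrier X → Carrier Y} {f′ : Carrier X → Carrier Z}
           (kf≈f′ : ∀ u → NomSet._≈_ Z (to k (f u)) (f′ u)) where

    chooseAbs-fuse : ∀ n u → NomSet._≈_ (𝕍^ n ×ₙ Z)
      (to (idₙ {𝕍^ n} ×₁ k) (chooseAbs {X} {Y} f n u)) (chooseAbs {X} {Z} f′ n u)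
    chooseAbs-fuse zero    u       = refl , kf≈f′ u
    chooseAbs-fuse (suc n) (x , u) = let (p , q) = chooseAbs-fuse n u in (refl , p) , q

    choose∏-fuse : ∀ ns s → NomSet._≈_ (F₀ (∏ᶠ (λ n → Const (𝕍^ n) ×ᶠ Id) ns) Z)
      (to (F₁ (∏ᶠ (λ n → Const (𝕍^ n) ×ᶠ Id) ns) k) (choose∏ {X} {Y} f ns s)) (choose∏ {X} {Z} f′ ns s)
    choose∏-fuse []       _       = refl
    choose∏-fuse (n ∷ ns) (u , s) = chooseAbs-fuse n u , choose∏-fuse ns s

    -- `F₁ (F S) k` leaves the chosen names alone, so only the leaves need `kf≈f′`. Both depth
    -- inductions below step by this, with `k` a connecting map or `a`.
    choose-fuse : ∀ S s → NomSet._≈_ (F₀ (F S) Z)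
      (to (F₁ (F S) k) (choose {X} {Y} f S s)) (choose {X} {Z} f′ S s)
    choose-fuse S (inj₁ x)        = inj₁ refl
    choose-fuse S (inj₂ (op , s)) = inj₂ (inj (choose∏-fuse (BindingSignature.ar S op) s))

  module _ {X Y : NomSet} (m : X ⇒ Y) where

    -- Rebinding the names just split off restores the representative, on which `F₁ (Abs^ n) m` also
    -- acts without renaming.
    θ^-chooseAbs : ∀ n u → NomSet._≈_ (F₀ (Abs^ n) Y)
      (to (θ^ n Y) (chooseAbs {X} {Y} (to m) n u)) (to (F₁ (Abs^ n) m) u)
    θ^-chooseAbs zero    u       = NomSet.refl Y
    θ^-chooseAbs (suc n) (x , u) = cong (θ (F₀ (Abs^ n) Y)) (refl , θ^-chooseAbs n u)

    ∏θ^-choose∏ : ∀ ns s → NomSet._≈_ (F₀ (∏ᶠ Abs^ ns) Y)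
      (to (η (∏ᵗ θ^-natural ns) Y) (choose∏ {X} {Y} (to m) ns s)) (to (F₁ (∏ᶠ Abs^ ns) m) s)
    ∏θ^-choose∏ []       _       = refl
    ∏θ^-choose∏ (n ∷ ns) (u , s) = θ^-chooseAbs n u , ∏θ^-choose∏ ns s

    q-choose : ∀ S s → NomSet._≈_ (F₀ (Fα S) Y)
      (to (η (q S) Y) (choose {X} {Y} (to m) S s)) (to (F₁ (Fα S) m) s)
    q-choose S (inj₁ x)        = inj₁ refl
    q-choose S (inj₂ (op , s)) = inj₂ (inj (∏θ^-choose∏ (BindingSignature.ar S op) s))

  module _ (S : BindingSignature) (Tα : Coalgebra (Fα S)) where
    open Coalgebra Tα renaming (carrier to T; structure to τ)

    unfold : ∀ n → Carrier T → Carrier (F S ^ n 𝟙)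
    unfold zero    _ = tt
    unfold (suc n) u = choose {T} {F S ^ n 𝟙} (unfold n) S (to τ u)

    unfold-compatible : ∀ n u → NomSet._≈_ (F S ^ n 𝟙)
      (to (connecting (F S) n) (unfold (suc n) u)) (unfold n u)
    unfold-compatible zero    u = refl
    -- Both depths take apart the same representative `to τ u`, so their outermost binders agree on
    -- the nose.
    unfold-compatible (suc n) u =
      choose-fuse {T} (connecting (F S) n) (unfold-compatible n) S (to τ u)

    a-unfold : ∀ n u → NomSet._≈_ (Fα S ^ n 𝟙)
      (to (a (q S) n) (unfold n u)) (to (canonical Tα n) u)
    a-unfold zero    u = refl
    -- First `a n` is absorbed into the leaves, turning `unfold n` into the equivariant
    -- `canonical Tα n`; then `q-choose` applies.
    a-unfold (suc n) u = NomSet.trans (Fα S ^ suc n 𝟙)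
      (cong (η (q S) (Fα S ^ n 𝟙)) (choose-fuse {T} (a (q S) n) (a-unfold n) S (to τ u)))
      (q-choose (canonical Tα n) S (to τ u))

    unfoldTuple : Carrier T → CompatibleTuple (U-terminalChain (F S))
    unfoldTuple u = record
      { component  = λ n → unfold n u
      ; compatible = λ n → unfold-compatible n u
      }

    h-surjective : Surjective (Setoid._≈_ (P S Tα)) (NomSet._≈_ T) (Func.to (h S Tα))
    -- `Surjective` concerns every point of `P` equal to the witness; such an equality has the
    -- required one in `T` as second component.
    h-surjective u = ((unfoldTuple u , u) , λ n → a-unfold n u) , proj₂

theorem5p32 : (𝒱 : Set) (𝒱↔ℕ : 𝒱 ↔ ℕ) → let open Nominal 𝒱 𝒱↔ℕ in
    (S : BindingSignature) → AtMostCountable (BindingSignature.Op S) →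
    (Tα : Coalgebra (Fα S)) → IsFinal Tα →
    Surjective (Setoid._≈_ (P S Tα)) (NomSet._≈_ (Coalgebra.carrier Tα)) (Func.to (h S Tα))
theorem5p32 𝒱 𝒱↔ℕ S _ Tα _ = h-surjective 𝒱 𝒱↔ℕ S Tα
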